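{- For every integer $t\geq 4$, every graph $G$ that does not contain $K_t$ as a minor has a connected partition $H_1,\dots,H_\ell$ such that for every $i\in\{1,\dots,\ell\}$: (1) $H_i$ is adjacent to at most $t-2$ of the subgraphs $H_1,\dots,H_{i-1}$; (2) $H_i$ has maximum degree at most $t-2$; and (3) $H_i$ is $2$-colourable with clustering $\lceil \tfrac12(t-2)\rceil$.
   Context: All graphs are finite and simple. A sequence $H_1,\dots,H_\ell$ is a connected partition of $G$ if each $H_i$ is a non-empty connected induced subgraph of $G$, the $H_i$ are pairwise vertex-disjoint, and $V(G)=V(H_1)\cup\dots\cup V(H_\ell)$. Two disjoint subgraphs $H,H'$ of $G$ are adjacent if some edge of $G$ has one endpoint in $H$ and the other in $H'$. A graph is $k$-colourable with clustering $c$ if its vertices can be assigned one of $k$ colours (not necessarily properly) so that every connected component of the subgraph induced by one colour class has at most $c$ vertices. -}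

module Defs where

open import Data.Nat using (ℕ; _≤_; _<_; _∸_; ⌈_/2⌉)
open import Data.Fin using (Fin; toℕ)
open import Data.Bool using (Bool; true; false)
open import Data.Maybe using (Maybe; just)
open import Data.List using (List; length)
open import Data.List.Relation.Unary.All using (All)
open import Data.List.Relation.Unary.Unique.Propositional using (Unique)
open import Data.Product using (Σ; ∃; _×_)
open import Relation.Binary.PropositionalEquality using (_≡_; _≢_)
open import Relation.Nullary using (¬_)

record Graph (n : ℕ) : Set where
  field
    adj   : Fin n → Fin n → Bool
    sym   : ∀ u v → adj u v ≡ adj v u
    irref : ∀ v → adj v v ≡ false

module _ {n : ℕ} (G : Graph n) where
  open Graph G

  Adj : Fin n → Fin n → Set
  Adj u v = adj u v ≡ true

  data Reach (S : Fin n → Set) (u : Fin n) : Fin n → Set where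
    here : S u → Reach S u u
    step : ∀ {w v} → Reach S u w → Adj w v → S v → Reach S u v

  ConnectedNonempty : (Fin n → Set) → Set
  ConnectedNonempty S = (∃ λ v → S v) × (∀ u v → S u → S v → Reach S u v)

  AdjacentSets : (Fin n → Set) → (Fin n → Set) → Set
  AdjacentSets S T = ∃ λ u → ∃ λ v → S u × T v × Adj u v

  -- G contains K_t as a minor: there are t pairwise disjoint non-empty connected
  -- branch sets (vertex v lies in branch set i iff β v ≡ just i), pairwise adjacent.
  HasCompleteMinor : ℕ → Set
  HasCompleteMinor t = Σ (Fin n → Maybe (Fin t)) λ β →
    (∀ i → ConnectedNonempty (λ v → β v ≡ just i)) ×
    (∀ i j → i ≢ j → AdjacentSets (λ v → β v ≡ just i) (λ v → β v ≡ just j))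

AtMost : ∀ {m} → ℕ → (Fin m → Set) → Set
AtMost {m} k P = ∀ (xs : List (Fin m)) → Unique xs → All P xs → length xs ≤ k

module _ {n : ℕ} (G : Graph n) where

  -- A connected partition H_1,…,H_ℓ encoded by part : Fin n → Fin ℓ
  -- (H_i = G[{v | part v ≡ i}]); parts indexed 0..ℓ-1 in order.
  Part : ∀ {ℓ} → (Fin n → Fin ℓ) → Fin ℓ → Fin n → Set
  Part part i v = part v ≡ i

  IsConnectedPartition : ∀ {ℓ} → (Fin n → Fin ℓ) → Set
  IsConnectedPartition {ℓ} part = ∀ (i : Fin ℓ) → ConnectedNonempty G (Part part i)

  FewEarlierNeighbours : ∀ {ℓ} → ℕ → (Fin n → Fin ℓ) → Fin ℓ → Set
  FewEarlierNeighbours k part i =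
    AtMost k (λ j → (toℕ j < toℕ i) × AdjacentSets G (Part part i) (Part part j))

  MaxDegreeAtMost : ∀ {ℓ} → ℕ → (Fin n → Fin ℓ) → Fin ℓ → Set
  MaxDegreeAtMost k part i =
    ∀ v → Part part i v → AtMost k (λ u → Part part i u × Adj G v u)

  TwoColourableClustering : ∀ {ℓ} → ℕ → (Fin n → Fin ℓ) → Fin ℓ → Set
  TwoColourableClustering c part i =
    Σ (Fin n → Fin 2) λ col →
      ∀ v → Part part i v →
        AtMost c (Reach G (λ w → Part part i w × col w ≡ col v) v)

{-# OPTIONS --safe #-}
module Submission where

-- Choose the parts one at a time. Let C be a component of the vertices not yet in a part. The earlier
-- parts adjacent to C are kept pairwise adjacent, so together with C they form a clique minor and there
-- are at most t - 2 of them. The next part is a connected H ⊆ C containing a set S of terminals: one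
-- vertex of C adjacent to each of these parts (any one vertex of C if there are none). The rest of C is
-- then adjacent only to H and to parts that are adjacent to H, which preserves the invariant.
--
-- H is found by pruning C. Order a connected vertex set so that each vertex is adjacent to an earlier one,
-- starting at a terminal r, and let v be the last non-terminal. Deleting v leaves the set L reachable from
-- r and a set K which consists of terminals only, since everything before v lies in L. If K is empty, drop
-- v. Otherwise recurse on L ∪ {v} with terminals (S ∖ K) ∪ {v} and put K back: K has edges to the rest of
-- H at v only. The degree bound is |S|, improved to |S| - 1 at terminals so that it survives putting K back
-- at v; in the 2-colouring, fewer than half of K get the colour of v and the rest get the other colour.

open import Defs
open import Data.Bool using (true)
import Data.Bool.Properties as Bool
open import Data.Fin using (Fin; zero; suc; toℕ; opposite; fromℕ<; inject≤)
open import Data.Fin.Properties as Fin using (_≟_; toℕ-fromℕ<; toℕ-injective; toℕ<n; inject≤-injective)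
open import Data.List using (List; []; _∷_; [_]; _++_; length; filter; take; drop; map; lookup; allFin; upTo)
open import Data.List.Membership.Propositional using (_∈_; _∉_; find; lose)
open import Data.List.Membership.Propositional.Properties
  using (∈-filter⁺; ∈-filter⁻; ∈-++⁺ˡ; ∈-++⁺ʳ; ∈-++⁻; ∈-allFin; ∈-upTo⁺; ∈-upTo⁻; ∈-lookup; ∈-map⁻)
open import Data.List.Properties
  using (length-take; length-drop; length-++; length-map; length-filter; length-tabulate;
    take++drop≡id; filter-notAll)
open import Data.List.Relation.Binary.Subset.Propositional using (_⊆_)
open import Data.List.Relation.Unary.All as All using (All; []; _∷_)
open import Data.List.Relation.Unary.All.Properties using (¬Any⇒All¬)
open import Data.List.Relation.Unary.AllPairs using ([]; _∷_)
open import Data.List.Relation.Unary.Any as Any using (Any; here; there; any?)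
open import Data.List.Relation.Unary.Unique.Propositional using (Unique)
import Data.List.Relation.Unary.Unique.Propositional.Properties as Unique
open import Data.Maybe using (Maybe; just; nothing)
open import Data.Nat as ℕ using (ℕ; zero; suc; _≤_; _<_; _+_; _∸_; z≤n; s≤s; s≤s⁻¹; ⌈_/2⌉; ⌊_/2⌋)
open import Data.Nat.Properties hiding (_≟_)
open import Data.Product using (Σ; ∃; ∃-syntax; _×_; _,_; proj₁; proj₂)
open import Data.Sum using (_⊎_; inj₁; inj₂; [_,_]′)
open import Function using (_∘_; id)
open import Relation.Binary.PropositionalEquality using (_≡_; _≢_; refl; sym; trans; cong; subst; ≢-sym)
open import Relation.Nullary using (¬_; Dec; yes; no; ¬?; contradiction)
open import Relation.Nullary.Decidable using (_×-dec_)

-- Covering lists, counting and rounding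

Covered : ∀ {A : Set} → ℕ → (A → Set) → Set
Covered {A} k P = ∃[ ys ] length ys ≤ k × (∀ {u : A} → P u → u ∈ ys)

covered-map : ∀ {A : Set} {P Q : A → Set} {k l} → k ≤ l → (∀ {u} → Q u → P u) → Covered k P → Covered l Q
covered-map k≤l f (ys , len , cov) = ys , ≤-trans len k≤l , cov ∘ f

unique-⊆-length : ∀ {A : Set} → (∀ (x y : A) → Dec (x ≡ y)) →
  ∀ {xs ys : List A} → Unique xs → xs ⊆ ys → length xs ≤ length ys
unique-⊆-length _≟ᴬ_ {[]} [] _ = z≤n
unique-⊆-length _≟ᴬ_ {x ∷ xs} {ys} (x≢ ∷ u) sub =
  ≤-trans (s≤s (unique-⊆-length _≟ᴬ_ u sub′)) (filter-notAll ≢x? ys (Any.map (λ eq ≢ → ≢ (sym eq)) (sub (here refl))))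
  where
  ≢x? : ∀ u → Dec (u ≢ x)
  ≢x? u = ¬? (u ≟ᴬ x)
  sub′ : xs ⊆ filter ≢x? ys
  sub′ p = ∈-filter⁺ ≢x? (sub (there p)) (≢-sym (All.lookup x≢ p))

length-partition : ∀ {A : Set} {P : A → Set} (P? : ∀ x → Dec (P x)) xs →
  length (filter P? xs) + length (filter (¬? ∘ P?) xs) ≡ length xs
length-partition P? [] = refl
length-partition P? (x ∷ xs) with P? x
... | yes _ = cong suc (length-partition P? xs)
... | no _ = trans (+-suc _ _) (cong suc (length-partition P? xs))

-- Rounding one summand down pays for rounding the other up. In `glue` the summands are the share of
-- `K` that joins the cluster of `v` and the bound on that cluster.
⌊/2⌋+⌈/2⌉≤ : ∀ a b → ⌊ a /2⌋ + ⌈ b /2⌉ ≤ ⌈ a + b /2⌉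
⌊/2⌋+⌈/2⌉≤ zero b = ≤-refl
⌊/2⌋+⌈/2⌉≤ (suc zero) b = ⌈n/2⌉-mono (n≤1+n b)
⌊/2⌋+⌈/2⌉≤ (suc (suc a)) b = s≤s (⌊/2⌋+⌈/2⌉≤ a b)

n∸⌈n/2⌉≡⌊n/2⌋ : ∀ n → n ∸ ⌈ n /2⌉ ≡ ⌊ n /2⌋
n∸⌈n/2⌉≡⌊n/2⌋ n = trans (cong (_∸ ⌈ n /2⌉) (sym (⌊n/2⌋+⌈n/2⌉≡n n))) (m+n∸n≡m ⌊ n /2⌋ ⌈ n /2⌉)

n∸⌊n/2⌋≡⌈n/2⌉ : ∀ n → n ∸ ⌊ n /2⌋ ≡ ⌈ n /2⌉
n∸⌊n/2⌋≡⌈n/2⌉ n = trans (cong (_∸ ⌊ n /2⌋) (sym (⌊n/2⌋+⌈n/2⌉≡n n))) (m+n∸m≡n ⌊ n /2⌋ ⌈ n /2⌉)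

opposite-≢ : (c : Fin 2) → opposite c ≢ c
opposite-≢ zero ()
opposite-≢ (suc zero) ()

∈-drop : ∀ {A : Set} m {xs : List A} {x} → x ∈ xs → x ∉ take m xs → x ∈ drop m xs
∈-drop m {xs} {x} p q with ∈-++⁻ (take m xs) (subst (x ∈_) (sym (take++drop≡id m xs)) p)
... | inj₁ p₁ = contradiction p₁ q
... | inj₂ p₂ = p₂

lookup-injective : ∀ {A : Set} {xs : List A} → Unique xs → ∀ i j → lookup xs i ≡ lookup xs j → i ≡ j
lookup-injective (_ ∷ _) zero zero _ = refl
lookup-injective (x≢ ∷ _) zero (suc j) eq = contradiction eq (All.lookup x≢ (∈-lookup j))
lookup-injective (x≢ ∷ _) (suc i) zero eq = contradiction (sym eq) (All.lookup x≢ (∈-lookup i))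
lookup-injective (_ ∷ u) (suc i) (suc j) eq = cong suc (lookup-injective u i j eq)

module _ {n : ℕ} where
  open import Data.List.Membership.DecPropositional (_≟_ {n}) public using (_∈?_)

  infixl 6 _∖_
  _∖_ : List (Fin n) → Fin n → List (Fin n)
  xs ∖ v = filter (λ u → ¬? (u ≟ v)) xs

  ∈-∖⁺ : ∀ {xs u v} → u ∈ xs → u ≢ v → u ∈ xs ∖ v
  ∈-∖⁺ {v = v} = ∈-filter⁺ (λ u → ¬? (u ≟ v))

  ∈-∖⁻ : ∀ {xs u v} → u ∈ xs ∖ v → u ∈ xs × u ≢ v
  ∈-∖⁻ {v = v} = ∈-filter⁻ (λ u → ¬? (u ≟ v))

  length-∖ : ∀ {xs v} → v ∈ xs → length (xs ∖ v) < length xs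
  length-∖ {xs} {v} p = filter-notAll (λ u → ¬? (u ≟ v)) xs (Any.map (λ eq ≢ → ≢ (sym eq)) p)

  unique-⊆-≤ : ∀ {xs ys : List (Fin n)} → Unique xs → xs ⊆ ys → length xs ≤ length ys
  unique-⊆-≤ = unique-⊆-length _≟_

  unique-∷ : ∀ {x} {xs : List (Fin n)} → x ∉ xs → Unique xs → Unique (x ∷ xs)
  unique-∷ x∉ u = ¬Any⇒All¬ _ x∉ ∷ u

  -- Covering bounds combine by appending lists, so the construction works with them; `AtMost`,
  -- which ranges over all duplicate-free lists, is recovered only at the end.
  covered⇒AtMost : ∀ {k} {P : Fin n → Set} → Covered k P → AtMost k P
  covered⇒AtMost (ys , len , cov) xs u all = ≤-trans (unique-⊆-≤ u (λ p → cov (All.lookup all p))) len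

-- Search orders, saturation and skeletons

module WithGraph {n : ℕ} (G : Graph n) where
  open Graph G using (adj)

  adj? : ∀ u v → Dec (Adj G u v)
  adj? u v = adj u v Bool.≟ true

  adj-sym : ∀ {u v} → Adj G u v → Adj G v u
  adj-sym {u} {v} p = trans (Graph.sym G v u) p

  adj-irrefl : ∀ {v} → ¬ Adj G v v
  adj-irrefl {v} p with trans (sym p) (Graph.irref G v)
  ... | ()

  -- A connected set with a search order, newest vertex first: every non-empty tail is again
  -- connected, and the root is the last entry.
  data Grown (r : Fin n) : List (Fin n) → Set where
    root : Grown r [ r ]
    grow : ∀ {x y xs} → Grown r xs → x ∉ xs → y ∈ xs → Adj G y x → Grown r (x ∷ xs)

  root∈ : ∀ {r xs} → Grown r xs → r ∈ xs
  root∈ root = here refl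
  root∈ (grow g _ _ _) = there (root∈ g)

  grown-unique : ∀ {r xs} → Grown r xs → Unique xs
  grown-unique root = [] ∷ []
  grown-unique (grow g x∉ _ _) = unique-∷ x∉ (grown-unique g)

  record Saturation (r : Fin n) (bs as : List (Fin n)) : Set where
    field
      {closure} : List (Fin n)
      grown     : Grown r closure
      extends   : bs ⊆ closure
      within    : ∀ {x} → x ∈ closure → x ∈ bs ⊎ x ∈ as
      closed    : ∀ {x y} → x ∈ as → x ∉ closure → y ∈ closure → ¬ Adj G y x

  -- The pool `as`, bounded by `m`, loses each vertex that is absorbed. Such a vertex is in the
  -- closure, so `closed` still holds for the whole original pool.
  saturate : ∀ m {r bs as} → length as ≤ m → Grown r bs → Saturation r bs as
  saturate m {r} {bs} {as} len g
    with any? (λ x → ¬? (x ∈? bs) ×-dec any? (λ y → adj? y x) bs) as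
  ... | no none = record
    { grown = g ; extends = id ; within = inj₁
    ; closed = λ p x∉ y∈ a → none (lose p (x∉ , lose y∈ a)) }
  saturate zero {as = []} z≤n g | yes ()
  saturate (suc m) {r} {bs} {as} len g | yes some
    with x , x∈ , x∉ , some-y ← find some
    with y , y∈ , a ← find some-y = record
    { grown = S.grown ; extends = S.extends ∘ there ; within = within′ ; closed = closed′ }
    where
    module S = Saturation (saturate m {bs = x ∷ bs} {as = as ∖ x} (s≤s⁻¹ (≤-trans (length-∖ x∈) len)) (grow g x∉ y∈ a))
    within′ : ∀ {z} → z ∈ S.closure → z ∈ bs ⊎ z ∈ as
    within′ p with S.within p
    ... | inj₁ (here refl) = inj₂ x∈
    ... | inj₁ (there q) = inj₁ q
    ... | inj₂ q = inj₂ (proj₁ (∈-∖⁻ q))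
    closed′ : ∀ {z w} → z ∈ as → z ∉ S.closure → w ∈ S.closure → ¬ Adj G w z
    closed′ z∈ z∉ = S.closed (∈-∖⁺ z∈ λ { refl → z∉ (S.extends (here refl)) }) z∉

  -- `verts` is the part to be found, between the terminals `S` and the ambient set `H`. The number
  -- `suc k` bounds the length of `S` and becomes t - 2. The sharper `degree-S` is what the
  -- recursion consumes: `v` is a terminal in the recursive call and an ordinary vertex afterwards.
  record Skeleton (k : ℕ) (H S : List (Fin n)) : Set where
    field
      {base}    : Fin n
      {verts}   : List (Fin n)
      grown     : Grown base verts
      verts⊆    : verts ⊆ H
      ⊆verts    : S ⊆ verts
      degree    : ∀ {w} → w ∈ verts → Covered (suc k) (λ u → u ∈ verts × Adj G w u)
      degree-S  : ∀ {w} → w ∈ S → Covered k (λ u → u ∈ verts × Adj G w u)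
      colour    : Fin n → Fin 2
      cluster   : ∀ {v} → v ∈ verts →
                  Covered ⌈ suc k /2⌉ (Reach G (λ w → w ∈ verts × colour w ≡ colour v) v)

  -- Base case: every vertex is a terminal

  reach-end : ∀ {S u v} → Reach G S u v → S v
  reach-end (here s) = s
  reach-end (step _ _ s) = s

  -- Here `H` has at most `suc k` vertices, so each has at most `k` neighbours, and cutting the list
  -- `H` after `⌈ suc k /2⌉` entries gives two colour classes that are small even as a whole.
  skeleton-small : ∀ {k r H S} → Grown r H → length S ≤ suc k → S ⊆ H → H ⊆ S → Skeleton k H S
  skeleton-small {k} {r} {H} {S} g S≤k S⊆H H⊆S = record
    { grown = g ; verts⊆ = id ; ⊆verts = S⊆H
    ; degree = λ w∈ → covered-map (n≤1+n k) id (deg w∈) ; degree-S = deg ∘ S⊆H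
    ; colour = col ; cluster = clus }
    where
    H≤k : length H ≤ suc k
    H≤k = ≤-trans (unique-⊆-≤ (grown-unique g) H⊆S) S≤k
    deg : ∀ {w} → w ∈ H → Covered k (λ u → u ∈ H × Adj G w u)
    deg {w} w∈ = H ∖ w , s≤s⁻¹ (≤-trans (length-∖ w∈) H≤k) ,
      λ { (u∈ , a) → ∈-∖⁺ u∈ λ { refl → adj-irrefl a } }
    h : ℕ
    h = ⌈ suc k /2⌉
    col : Fin n → Fin 2
    col u with u ∈? take h H
    ... | yes _ = zero
    ... | no _ = suc zero
    clus : ∀ {v} → v ∈ H → Covered h (Reach G (λ w → w ∈ H × col w ≡ col v) v)
    clus {v} v∈ with v ∈? take h H
    ... | yes _ = take h H , subst (_≤ h) (sym (length-take h H)) (m⊓n≤m h _) , λ ρ → inside (reach-end ρ)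
      where
      inside : ∀ {u} → u ∈ H × col u ≡ zero → u ∈ take h H
      inside {u} (_ , eq) with u ∈? take h H
      inside (_ , _) | yes p = p
      inside (_ , ()) | no _
    ... | no _ = drop h H , bound , λ ρ → outside (reach-end ρ)
      where
      bound : length (drop h H) ≤ h
      bound = begin
        length (drop h H) ≡⟨ length-drop h H ⟩
        length H ∸ h      ≤⟨ ∸-monoˡ-≤ h H≤k ⟩
        suc k ∸ h         ≡⟨ n∸⌈n/2⌉≡⌊n/2⌋ (suc k) ⟩
        ⌊ suc k /2⌋       ≤⟨ ⌊n/2⌋≤⌈n/2⌉ (suc k) ⟩
        h                 ∎
        where open ≤-Reasoning
      outside : ∀ {u} → u ∈ H × col u ≡ suc zero → u ∈ drop h H
      outside {u} (_ , _) with u ∈? take h H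
      outside (_ , ()) | yes _
      outside (u∈ , _) | no ∉ = ∈-drop h u∈ ∉

  -- Cutting at the last non-terminal and gluing back

  record LastOutside (r : Fin n) (H S : List (Fin n)) : Set where
    field
      {older}   : List (Fin n)
      {v anchor} : Fin n
      v∈        : v ∈ H
      v∉S       : v ∉ S
      grown     : Grown r older
      older⊆    : older ⊆ H
      v∉older   : v ∉ older
      anchor∈   : anchor ∈ older
      edge      : Adj G anchor v
      newer     : ∀ {x} → x ∈ H → x ≢ v → x ∉ older → x ∈ S

  -- The list is scanned from its newest end and the first non-terminal met is taken. As the root is
  -- a terminal, that vertex has an older neighbour, its `anchor`.
  last-outside : ∀ {r H S} → Grown r H → r ∈ S → H ⊆ S ⊎ LastOutside r H S
  last-outside root r∈ = inj₁ λ { (here refl) → r∈ }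
  last-outside {S = S} (grow {x} g x∉ y∈ a) r∈ with x ∈? S
  ... | no x∉S = inj₂ record
    { v∈ = here refl ; v∉S = x∉S ; grown = g ; older⊆ = there ; v∉older = x∉ ; anchor∈ = y∈ ; edge = a
    ; newer = λ { (here eq) ≢ _ → contradiction eq ≢ ; (there p) _ ∉ → contradiction p ∉ } }
  ... | yes x∈S with last-outside g r∈
  ... | inj₁ sub = inj₁ λ { (here refl) → x∈S ; (there p) → sub p }
  ... | inj₂ o = inj₂ record
    { v∈ = there O.v∈ ; v∉S = O.v∉S ; grown = O.grown ; older⊆ = there ∘ O.older⊆ ; v∉older = O.v∉older
    ; anchor∈ = O.anchor∈ ; edge = O.edge
    ; newer = λ { (here refl) _ _ → x∈S ; (there p) → O.newer p } }
    where module O = LastOutside o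

  -- The vertices of `K` are added to `M` in their order in `H`. The older neighbour that attached
  -- such a vertex is itself in `K`, hence already added, or is `v`, which is in `M`. The root has
  -- no older neighbour and so has to lie outside `K`.
  regrow : ∀ {r H r′ M v} {K : Fin n → Set} (K? : ∀ x → Dec (K x)) →
    Grown r H → Grown r′ M → v ∈ M → (∀ {x} → x ∈ M → ¬ K x) → ¬ K r →
    (∀ {x y} → x ∈ H → y ∈ H → K x → Adj G y x → K y ⊎ y ≡ v) →
    Grown r′ (filter K? H ++ M)
  regrow {r} K? root gM v∈ M∌ ¬Kr cut with K? r
  ... | yes Kr = contradiction Kr ¬Kr
  ... | no _ = gM
  regrow {M = M} K? (grow {x} {y} {xs} g x∉ y∈ a) gM v∈ M∌ ¬Kr cut
    with rec ← regrow K? g gM v∈ M∌ ¬Kr (λ p q → cut (there p) (there q))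
    with K? x
  ... | no _ = rec
  ... | yes Kx = grow rec fresh attached a
    where
    fresh : x ∉ filter K? xs ++ M
    fresh p with ∈-++⁻ (filter K? xs) p
    ... | inj₁ q = x∉ (proj₁ (∈-filter⁻ K? q))
    ... | inj₂ q = M∌ q Kx
    attached : y ∈ filter K? xs ++ M
    attached with cut (here refl) (there y∈) Kx a
    ... | inj₁ Ky = ∈-++⁺ˡ (∈-filter⁺ K? y∈ Ky)
    ... | inj₂ refl = ∈-++⁺ʳ (filter K? xs) v∈

  -- In use, the `suc m` terminals in `K` were replaced by `v` alone, which is why the budget of
  -- `Sk` is smaller by `m`. As `K` meets `verts` only at `v`, no other vertex of `verts` gains
  -- neighbours, and only the cluster of `v` can grow.
  glue : ∀ {k k₂ m H H₂ S S₂ K v b} (Sk : Skeleton k₂ H₂ S₂) → let open Skeleton Sk in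
    length K ≡ suc m → m + k₂ ≡ k → suc m ≤ k →
    Grown b (K ++ verts) → K ⊆ H → H₂ ⊆ H →
    v ∈ S₂ → v ∉ S → K ⊆ S → (∀ {x} → x ∈ S → x ∈ K ⊎ x ∈ S₂) →
    (∀ {x} → x ∈ verts → x ∉ K) → (∀ {x y} → x ∈ K → y ∈ verts → Adj G y x → y ≡ v) →
    Skeleton k H S
  glue {k} {k₂} {m} {H} {H₂} {S} {S₂} {K} {v} Sk |K| mk₂ m<k gr K⊆H H₂⊆H v∈S₂ v∉S K⊆S S⊆ disj cut = record
    { grown = gr
    ; verts⊆ = λ p → [ K⊆H , H₂⊆H ∘ M.verts⊆ ]′ (∈-++⁻ K p)
    ; ⊆verts = λ p → [ ∈-++⁺ˡ , ∈-++⁺ʳ K ∘ M.⊆verts ]′ (S⊆ p)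
    ; degree = λ p → [ (λ w∈K → covered-map (n≤1+n k) id (deg-K w∈K)) , deg-M ]′ (∈-++⁻ K p)
    ; degree-S = deg-S
    ; colour = col
    ; cluster = clus
    }
    where
    module M = Skeleton Sk
    k₂≤k : k₂ ≤ k
    k₂≤k = subst (k₂ ≤_) mk₂ (m≤n+m k₂ m)
    v∈M : v ∈ M.verts
    v∈M = M.⊆verts v∈S₂

    V : Fin n → Set
    V u = u ∈ K ++ M.verts

    deg-K : ∀ {w} → w ∈ K → Covered k (λ u → V u × Adj G w u)
    deg-K {w} w∈ =
      (v ∷ K) ∖ w , ≤-trans (s≤s⁻¹ (length-∖ {xs = v ∷ K} {w} (there w∈))) (subst (_≤ k) (sym |K|) m<k) , cov
      where
      cov : ∀ {u} → V u × Adj G w u → u ∈ (v ∷ K) ∖ w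
      cov (u∈ , a) with ∈-++⁻ K u∈
      ... | inj₁ u∈K = ∈-∖⁺ {xs = v ∷ K} (there u∈K) λ { refl → adj-irrefl a }
      ... | inj₂ u∈M = ∈-∖⁺ {xs = v ∷ K} (here (cut w∈ u∈M (adj-sym a))) λ { refl → disj u∈M w∈ }

    inside-M : ∀ {w} → w ∈ M.verts → w ≢ v → ∀ {u} → V u × Adj G w u → u ∈ M.verts × Adj G w u
    inside-M w∈ w≢v (u∈ , a) with ∈-++⁻ K u∈
    ... | inj₁ u∈K = contradiction (cut u∈K w∈ a) w≢v
    ... | inj₂ u∈M = u∈M , a

    deg-S : ∀ {w} → w ∈ S → Covered k (λ u → V u × Adj G w u)
    deg-S w∈S with S⊆ w∈S
    ... | inj₁ w∈K = deg-K w∈K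
    ... | inj₂ w∈S₂ = covered-map k₂≤k (inside-M (M.⊆verts w∈S₂) λ { refl → v∉S w∈S }) (M.degree-S w∈S₂)

    deg-M : ∀ {w} → w ∈ M.verts → Covered (suc k) (λ u → V u × Adj G w u)
    deg-M {w} w∈ with w ≟ v
    ... | no w≢v = covered-map (s≤s k₂≤k) (inside-M w∈ w≢v) (M.degree w∈)
    -- As a terminal of `Sk`, `v` has at most `k₂` neighbours there, which leaves room for the
    -- `suc m` vertices of `K`.
    ... | yes refl with ys , len , cov ← M.degree-S v∈S₂ = K ++ ys , bound , cov′
      where
      bound : length (K ++ ys) ≤ suc k
      bound = begin
        length (K ++ ys)     ≡⟨ length-++ K ⟩
        length K + length ys ≤⟨ +-mono-≤ (≤-reflexive |K|) len ⟩
        suc m + k₂           ≡⟨ cong suc mk₂ ⟩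
        suc k                ∎
        where open ≤-Reasoning
      cov′ : ∀ {u} → V u × Adj G w u → u ∈ K ++ ys
      cov′ (u∈ , a) with ∈-++⁻ K u∈
      ... | inj₁ u∈K = ∈-++⁺ˡ u∈K
      ... | inj₂ u∈M = ∈-++⁺ʳ K (cov (u∈M , a))

    -- K₁ gets the colour of v and can only enlarge the cluster of v; K₂ gets the other colour and has no
    -- neighbour of that colour outside K.
    K₁ K₂ : List (Fin n)
    K₁ = take ⌊ m /2⌋ K
    K₂ = drop ⌊ m /2⌋ K

    K₁⊆K : K₁ ⊆ K
    K₁⊆K p = subst (_ ∈_) (take++drop≡id ⌊ m /2⌋ K) (∈-++⁺ˡ p)

    |K₁| : length K₁ ≤ ⌊ m /2⌋
    |K₁| = subst (_≤ ⌊ m /2⌋) (sym (length-take ⌊ m /2⌋ K)) (m⊓n≤m ⌊ m /2⌋ _)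

    |K₂| : length K₂ ≤ ⌈ suc k /2⌉
    |K₂| = begin
      length K₂             ≡⟨ length-drop ⌊ m /2⌋ K ⟩
      length K ∸ ⌊ m /2⌋    ≡⟨ cong (_∸ ⌊ m /2⌋) |K| ⟩
      suc m ∸ ⌊ m /2⌋       ≡⟨ +-∸-assoc 1 (⌊n/2⌋≤n m) ⟩
      suc (m ∸ ⌊ m /2⌋)     ≡⟨ cong suc (n∸⌊n/2⌋≡⌈n/2⌉ m) ⟩
      -- The bound `suc m ≤ k` makes the larger share of `K` fit into one cluster.
      ⌈ suc (suc m) /2⌉     ≤⟨ ⌈n/2⌉-mono (s≤s m<k) ⟩
      ⌈ suc k /2⌉           ∎
      where open ≤-Reasoning

    c : Fin 2
    c = M.colour v

    col : Fin n → Fin 2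
    col u with u ∈? K₁
    ... | yes _ = c
    ... | no _ with u ∈? K
    ... | yes _ = opposite c
    ... | no _ = M.colour u

    col-K₁ : ∀ {u} → u ∈ K₁ → col u ≡ c
    col-K₁ {u} p with u ∈? K₁
    ... | yes _ = refl
    ... | no ¬p = contradiction p ¬p

    col-K∖K₁ : ∀ {u} → u ∈ K → u ∉ K₁ → col u ≡ opposite c
    col-K∖K₁ {u} p ¬q with u ∈? K₁
    ... | yes q = contradiction q ¬q
    ... | no _ with u ∈? K
    ... | yes _ = refl
    ... | no ¬p = contradiction p ¬p

    col-M : ∀ {u} → u ∈ M.verts → col u ≡ M.colour u
    col-M {u} p with u ∈? K₁
    ... | yes q = contradiction (K₁⊆K q) (disj p)
    ... | no _ with u ∈? K
    ... | yes q = contradiction q (disj p)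
    ... | no _ = refl

    M-cluster : Fin n → Fin n → Set
    M-cluster s = Reach G (λ w → w ∈ M.verts × M.colour w ≡ M.colour s) s

    V-cluster : Fin n → Fin n → Set
    V-cluster s = Reach G (λ w → V w × col w ≡ col s) s

    K₂-cluster : ∀ {s u} → s ∈ K → s ∉ K₁ → V-cluster s u → u ∈ K × u ∉ K₁
    K₂-cluster s∈ s∉ (here _) = s∈ , s∉
    K₂-cluster {s} {u} s∈ s∉ (step ρ a (u∈ , eq)) with K₂-cluster s∈ s∉ ρ
    ... | w∈ , _ with ∈-++⁻ K u∈
    ... | inj₁ u∈K = u∈K , λ u∈K₁ → opposite-≢ c (trans (sym (trans eq (col-K∖K₁ s∈ s∉))) (col-K₁ u∈K₁))
    ... | inj₂ u∈M with refl ← cut w∈ u∈M (adj-sym a) =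
      contradiction (trans (sym (trans eq (col-K∖K₁ s∈ s∉))) (col-M u∈M)) (opposite-≢ c)

    -- A walk in one colour passes between `K` and `M.verts` only through `v`. While it is in `K`,
    -- the invariant keeps the fact that `v` belongs to the cluster of `t`, so a return to `M.verts`
    -- lands in that same cluster.
    M-extended : ∀ {s t u} → col s ≡ M.colour t → (s ∈ K × M-cluster t v) ⊎ M-cluster t s →
      V-cluster s u → (u ∈ K × M-cluster t v) ⊎ M-cluster t u
    M-extended s~t σ₀ (here _) = σ₀
    M-extended s~t σ₀ (step ρ a (u∈ , eq)) with M-extended s~t σ₀ ρ | ∈-++⁻ K u∈
    ... | inj₁ (_ , σ) | inj₁ u∈K = inj₁ (u∈K , σ)
    ... | inj₁ (w∈ , σ) | inj₂ u∈M with refl ← cut w∈ u∈M (adj-sym a) = inj₂ σ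
    M-extended s~t σ₀ (step ρ a (u∈ , eq)) | inj₂ σ | inj₁ u∈K
      with refl ← cut u∈K (proj₁ (reach-end σ)) a = inj₁ (u∈K , σ)
    M-extended s~t σ₀ (step ρ a (u∈ , eq)) | inj₂ σ | inj₂ u∈M =
      inj₂ (step σ a (u∈M , trans (sym (col-M u∈M)) (trans eq s~t)))

    M-extended-K₁ : ∀ {s t u} → col s ≡ M.colour t → (s ∈ K × M-cluster t v) ⊎ M-cluster t s →
      V-cluster s u → u ∈ K₁ ⊎ M-cluster t u
    M-extended-K₁ {u = u} s~t σ₀ ρ with M-extended s~t σ₀ ρ
    ... | inj₂ σ = inj₂ σ
    ... | inj₁ (u∈K , σ) with u ∈? K₁
    ... | yes p = inj₁ p
    -- `u` has the colour of `t`, hence that of `v`, which the vertices of `K` outside `K₁` do not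
    -- have.
    ... | no ¬p = contradiction
      (trans (sym (col-K∖K₁ u∈K ¬p)) (trans (proj₂ (reach-end ρ)) (trans s~t (sym (proj₂ (reach-end σ))))))
      (opposite-≢ c)

    K₁-++ : ∀ {s} → s ∈ M.verts → Covered ⌈ suc k /2⌉ (λ u → u ∈ K₁ ⊎ M-cluster s u)
    K₁-++ s∈ with ys , len , cov ← M.cluster s∈ = K₁ ++ ys , bound , [ ∈-++⁺ˡ , ∈-++⁺ʳ K₁ ∘ cov ]′
      where
      bound : length (K₁ ++ ys) ≤ ⌈ suc k /2⌉
      bound = begin
        length (K₁ ++ ys)             ≡⟨ length-++ K₁ ⟩
        length K₁ + length ys         ≤⟨ +-mono-≤ |K₁| len ⟩
        ⌊ m /2⌋ + ⌈ suc k₂ /2⌉        ≤⟨ ⌊/2⌋+⌈/2⌉≤ m (suc k₂) ⟩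
        ⌈ m + suc k₂ /2⌉              ≡⟨ cong ⌈_/2⌉ (trans (+-suc m k₂) (cong suc mk₂)) ⟩
        ⌈ suc k /2⌉                   ∎
        where open ≤-Reasoning

    clus-K : ∀ {s} → s ∈ K → Dec (s ∈ K₁) → Covered ⌈ suc k /2⌉ (V-cluster s)
    clus-K s∈K (yes s∈K₁) =
      -- The reference vertex is `v`, which has the colour of `K₁` and lies in its own cluster.
      covered-map ≤-refl (M-extended-K₁ (col-K₁ s∈K₁) (inj₁ (s∈K , here (v∈M , refl)))) (K₁-++ v∈M)
    clus-K s∈K (no s∉K₁) = K₂ , |K₂| , λ ρ → let u∈ , u∉ = K₂-cluster s∈K s∉K₁ ρ in ∈-drop ⌊ m /2⌋ u∈ u∉

    clus : ∀ {s} → V s → Covered ⌈ suc k /2⌉ (V-cluster s)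
    clus {s} s∈ with ∈-++⁻ K s∈
    ... | inj₁ s∈K = clus-K s∈K (s ∈? K₁)
    ... | inj₂ s∈M =
      covered-map ≤-refl (M-extended-K₁ (col-M s∈M) (inj₂ (here (s∈M , refl)))) (K₁-++ s∈M)

  -- Skeletons by recursion

  skeleton-rec : ∀ m {k r H S} → length H ≤ m → Grown r H → length S ≤ suc k → r ∈ S → S ⊆ H → Skeleton k H S
  skeleton-rec m {k} {r} {H} {S} H≤m g S≤k r∈S S⊆H with last-outside g r∈S
  skeleton-rec m H≤m g S≤k r∈S S⊆H | inj₁ H⊆S = skeleton-small g S≤k S⊆H H⊆S
  skeleton-rec zero {H = []} z≤n () S≤k r∈S S⊆H | inj₂ o
  -- Both recursive calls are on shorter lists: `L` lacks `v`, and `v ∷ L` lacks the non-empty `K`.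
  skeleton-rec (suc m) {k} {r} {H} {S} H≤m g S≤k r∈S S⊆H | inj₂ o = result
    where
    module O = LastOutside o
    v : Fin n
    v = O.v
    -- Saturation starts from the whole of `older`, so what stays outside `v ∷ L` came after `v` and
    -- is a terminal.
    module L = Saturation (saturate (length (H ∖ v)) {as = H ∖ v} ≤-refl O.grown)
    L : List (Fin n)
    L = L.closure
    Out : Fin n → Set
    Out x = x ∉ v ∷ L
    Out? : ∀ x → Dec (Out x)
    Out? x = ¬? (x ∈? v ∷ L)
    K : List (Fin n)
    K = filter Out? H
    L⊆H : L ⊆ H
    L⊆H p = [ O.older⊆ , proj₁ ∘ ∈-∖⁻ ]′ (L.within p)
    v∉L : v ∉ L
    v∉L p = [ O.v∉older , (λ q → proj₂ (∈-∖⁻ {xs = H} q) refl) ]′ (L.within p)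
    vL⊆H : v ∷ L ⊆ H
    vL⊆H (here refl) = O.v∈
    vL⊆H (there p) = L⊆H p
    K⁻ : ∀ {x} → x ∈ K → x ∈ H × Out x
    K⁻ = ∈-filter⁻ Out?
    K⊆S : K ⊆ S
    K⊆S p = let x∈ , out = K⁻ p in O.newer x∈ (out ∘ here) (out ∘ there ∘ L.extends)
    S⊆ : ∀ {x} → x ∈ S → x ∈ K ⊎ x ∈ L
    S⊆ {x} p with x ∈? v ∷ L
    ... | yes (here refl) = contradiction p O.v∉S
    ... | yes (there q) = inj₂ q
    ... | no out = inj₁ (∈-filter⁺ Out? (S⊆H p) out)
    r∈L : r ∈ L
    r∈L = root∈ L.grown
    cut : ∀ {x y} → x ∈ H → Out x → y ∈ L → ¬ Adj G y x
    cut x∈ out y∈ = L.closed (∈-∖⁺ x∈ (out ∘ here)) (out ∘ there) y∈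
    gvL : Grown r (v ∷ L)
    gvL = grow L.grown v∉L (L.extends O.anchor∈) O.edge

    split : ∀ l → length K ≡ l → Skeleton k H S
    split zero |K| = record
      { grown = Sk.grown ; verts⊆ = L⊆H ∘ Sk.verts⊆ ; ⊆verts = Sk.⊆verts
      ; degree = Sk.degree ; degree-S = Sk.degree-S ; colour = Sk.colour ; cluster = Sk.cluster }
      where
      S⊆L : S ⊆ L
      S⊆L p with S⊆ p
      ... | inj₂ q = q
      ... | inj₁ q = contradiction (subst (length (K ∖ _) <_) |K| (length-∖ q)) λ ()
      module Sk = Skeleton (skeleton-rec m
        (s≤s⁻¹ (≤-trans (unique-⊆-≤ (grown-unique gvL) vL⊆H) H≤m)) L.grown S≤k r∈S S⊆L)
    split (suc l) |K| = glue Sk |K| l+k₂≡k l<k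
      (regrow Out? g Sk.grown (Sk.⊆verts (here refl)) (λ p out → out (Sk.verts⊆ p)) (λ out → out (there r∈L)) leave)
      (proj₁ ∘ K⁻) vL⊆H (here refl) O.v∉S K⊆S S-split
      (λ p q → proj₂ (K⁻ q) (Sk.verts⊆ p))
      (λ p q a → attach (K⁻ p) (Sk.verts⊆ q) a)
      where
      inK? : ∀ x → Dec (x ∈ K)
      inK? x = x ∈? K
      R : List (Fin n)
      R = filter (¬? ∘ inK?) S
      r∈R : r ∈ R
      r∈R = ∈-filter⁺ (¬? ∘ inK?) r∈S λ p → proj₂ (K⁻ p) (there r∈L)
      K-unique : Unique K
      K-unique = Unique.filter⁺ Out? (grown-unique g)
      K+R≤ : suc l + length R ≤ suc k
      K+R≤ = begin
        suc l + length R                     ≡⟨ cong (_+ length R) (sym |K|) ⟩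
        length K + length R                  ≤⟨ +-monoˡ-≤ (length R) (unique-⊆-≤ K-unique λ p → ∈-filter⁺ inK? (K⊆S p) p) ⟩
        length (filter inK? S) + length R    ≡⟨ length-partition inK? S ⟩
        length S                             ≤⟨ S≤k ⟩
        suc k                                ∎
        where open ≤-Reasoning
      l+R≤k : l + length R ≤ k
      l+R≤k = s≤s⁻¹ K+R≤
      l<k : l < k
      l<k = begin
        suc l          ≡⟨ +-comm 1 l ⟩
        -- `R` contains the root `r`, so at least one terminal lies outside `K`.
        l + 1          ≤⟨ +-monoʳ-≤ l (≤-trans (s≤s z≤n) (length-∖ r∈R)) ⟩
        l + length R   ≤⟨ l+R≤k ⟩
        k              ∎
        where open ≤-Reasoning
      k₂ : ℕ
      -- The terminal list loses at least `suc l` entries with `K` and gains `v`, so the budget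
      -- drops by `l`.
      k₂ = k ∸ l
      l+k₂≡k : l + k₂ ≡ k
      l+k₂≡k = m+[n∸m]≡n (<⇒≤ l<k)
      R≤k₂ : length R ≤ k₂
      R≤k₂ = +-cancelˡ-≤ l (length R) k₂ (≤-trans l+R≤k (≤-reflexive (sym l+k₂≡k)))
      vL⊆¬Out : v ∷ L ⊆ filter (¬? ∘ Out?) H
      vL⊆¬Out p = ∈-filter⁺ (¬? ∘ Out?) (vL⊆H p) λ out → out p
      vL≤m : length (v ∷ L) ≤ m
      vL≤m = s≤s⁻¹ (begin
        suc (length (v ∷ L))                           ≤⟨ s≤s (unique-⊆-≤ (grown-unique gvL) vL⊆¬Out) ⟩
        suc (length (filter (¬? ∘ Out?) H))            ≤⟨ s≤s (m≤n+m _ l) ⟩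
        suc l + length (filter (¬? ∘ Out?) H)          ≡⟨ cong (_+ length (filter (¬? ∘ Out?) H)) (sym |K|) ⟩
        length K + length (filter (¬? ∘ Out?) H)       ≡⟨ length-partition Out? H ⟩
        length H                                       ≤⟨ H≤m ⟩
        suc m                                          ∎)
        where open ≤-Reasoning
      vR⊆vL : v ∷ R ⊆ v ∷ L
      vR⊆vL (here eq) = here eq
      vR⊆vL (there p) with p∈S , p∉K ← ∈-filter⁻ (¬? ∘ inK?) {xs = S} p with S⊆ p∈S
      ... | inj₁ q = contradiction q p∉K
      ... | inj₂ q = there q
      Sk : Skeleton k₂ (v ∷ L) (v ∷ R)
      Sk = skeleton-rec m vL≤m gvL (s≤s R≤k₂) (there r∈R) vR⊆vL
      module Sk = Skeleton Sk
      S-split : ∀ {x} → x ∈ S → x ∈ K ⊎ x ∈ v ∷ R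
      S-split {x} p with x ∈? K
      ... | yes q = inj₁ q
      ... | no ¬q = inj₂ (there (∈-filter⁺ (¬? ∘ inK?) p ¬q))
      leave : ∀ {x y} → x ∈ H → y ∈ H → Out x → Adj G y x → Out y ⊎ y ≡ v
      leave {x} {y} x∈ y∈ out a with y ∈? v ∷ L
      ... | no ¬p = inj₁ ¬p
      ... | yes (here eq) = inj₂ eq
      ... | yes (there p) = contradiction a (cut x∈ out p)
      attach : ∀ {x y} → x ∈ H × Out x → y ∈ v ∷ L → Adj G y x → y ≡ v
      attach _ (here eq) _ = eq
      attach (x∈ , out) (there p) a = contradiction a (cut x∈ out p)

    result : Skeleton k H S
    result = split (length K) refl

  abstract
    skeleton : ∀ {k r H S} → Grown r H → length S ≤ suc k → r ∈ S → S ⊆ H → Skeleton k H S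
    skeleton = skeleton-rec _ ≤-refl

  -- Reachability, components and complete minors

  reach-start : ∀ {S u v} → Reach G S u v → S u
  reach-start (here s) = s
  reach-start (step ρ _ _) = reach-start ρ

  reach-map : ∀ {S T : Fin n → Set} → (∀ {w} → S w → T w) → ∀ {u v} → Reach G S u v → Reach G T u v
  reach-map f (here s) = here (f s)
  reach-map f (step ρ a s) = step (reach-map f ρ) a (f s)

  reach-trans : ∀ {S u v w} → Reach G S u v → Reach G S v w → Reach G S u w
  reach-trans ρ (here _) = ρ
  reach-trans ρ (step σ a s) = step (reach-trans ρ σ) a s

  reach-sym : ∀ {S u v} → Reach G S u v → Reach G S v u
  reach-sym (here s) = here s
  reach-sym (step ρ a s) = reach-trans (step (here s) (adj-sym a) (reach-end ρ)) (reach-sym ρ)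

  adjacent-sym : ∀ {S T} → AdjacentSets G S T → AdjacentSets G T S
  adjacent-sym (u , v , s , t , a) = v , u , t , s , adj-sym a

  adjacent-map : ∀ {S S′ T T′ : Fin n → Set} → (∀ {w} → S w → S′ w) → (∀ {w} → T w → T′ w) →
    AdjacentSets G S T → AdjacentSets G S′ T′
  adjacent-map f g (u , v , s , t , a) = u , v , f s , g t , a

  connected-map : ∀ {S T : Fin n → Set} → (∀ {w} → S w → T w) → (∀ {w} → T w → S w) →
    ConnectedNonempty G S → ConnectedNonempty G T
  connected-map f g ((v , s) , conn) = (v , f s) , λ u w tu tw → reach-map f (conn u w (g tu) (g tw))

  grown-reach : ∀ {r xs x} → Grown r xs → x ∈ xs → Reach G (_∈ xs) r x
  grown-reach root (here refl) = here (here refl)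
  grown-reach (grow g _ y∈ a) (here refl) = step (reach-map there (grown-reach g y∈)) a (here refl)
  grown-reach (grow g _ _ _) (there p) = reach-map there (grown-reach g p)

  grown-connected : ∀ {r xs} → Grown r xs → ConnectedNonempty G (_∈ xs)
  grown-connected g = (_ , root∈ g) , λ u v u∈ v∈ → reach-trans (reach-sym (grown-reach g u∈)) (grown-reach g v∈)

  record Component (P : Fin n → Set) (r : Fin n) : Set where
    field
      {verts} : List (Fin n)
      grown   : Grown r verts
      inside  : ∀ {x} → x ∈ verts → P x
      closed  : ∀ {x y} → y ∈ verts → P x → Adj G y x → x ∈ verts

    reach-closed : ∀ {u v} → u ∈ verts → Reach G P u v → v ∈ verts
    reach-closed u∈ (here _) = u∈
    reach-closed u∈ (step ρ a p) = closed (reach-closed u∈ ρ) p a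

  abstract
    component : ∀ {P : Fin n → Set} (P? : ∀ x → Dec (P x)) {r} → P r → Component P r
    component {P} P? {r} Pr = record { grown = Sat.grown ; inside = inside ; closed = closed }
      where
      pool : List (Fin n)
      pool = filter P? (allFin n)
      module Sat = Saturation (saturate (length pool) {as = pool} ≤-refl (root {r}))
      inside : ∀ {x} → x ∈ Sat.closure → P x
      inside p with Sat.within p
      ... | inj₁ (here refl) = Pr
      ... | inj₂ q = proj₂ (∈-filter⁻ P? {xs = allFin n} q)
      closed : ∀ {x y} → y ∈ Sat.closure → P x → Adj G y x → x ∈ Sat.closure
      closed {x} y∈ Px a with x ∈? Sat.closure
      ... | yes p = p
      ... | no ¬p = contradiction a (Sat.closed (∈-filter⁺ P? (∈-allFin x) Px) ¬p y∈)

  -- By disjointness, the index that the search finds at a vertex is the only one whose branch set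
  -- contains it.
  complete-minor : ∀ {t} (B : Fin t → Fin n → Set) → (∀ i v → Dec (B i v)) →
    (∀ {i j v} → B i v → B j v → i ≡ j) → (∀ i → ConnectedNonempty G (B i)) →
    (∀ i j → i ≢ j → AdjacentSets G (B i) (B j)) → HasCompleteMinor G t
  complete-minor {t} B B? disjoint conn adjacent =
    (λ v → branch (Fin.any? (λ i → B? i v)))
    , (λ i → connected-map (to _) (from _) (conn i))
    , (λ i j i≢j → adjacent-map (to _) (to _) (adjacent i j i≢j))
    where
    branch : ∀ {v} → Dec (∃ λ i → B i v) → Maybe (Fin t)
    branch (yes (i , _)) = just i
    branch (no _) = nothing
    to : ∀ {v i} (d : Dec (∃ λ i → B i v)) → B i v → branch d ≡ just i
    to (yes (_ , b)) b′ = cong just (disjoint b b′)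
    to (no ¬b) b′ = contradiction (_ , b′) ¬b
    from : ∀ {v i} (d : Dec (∃ λ i → B i v)) → branch d ≡ just i → B i v
    from (yes (_ , b)) refl = b

  -- Partial partitions as labellings

  Touches : (Fin n → ℕ) → Fin n → ℕ → Set
  Touches lab x j = ∃[ w ] lab w ≡ j × Adj G x w

  touches? : ∀ lab x j → Dec (Touches lab x j)
  touches? lab x j = Fin.any? (λ w → (lab w ℕ.≟ j) ×-dec adj? x w)

  record Block (k : ℕ) (lab : Fin n → ℕ) (i : ℕ) : Set where
    field
      {H S}   : List (Fin n)
      skel    : Skeleton k H S
    open Skeleton skel public
    field
      label   : ∀ {v} → v ∈ verts → lab v ≡ i
      labelled : ∀ {v} → lab v ≡ i → v ∈ verts
      earlier : Covered (suc k) (λ j → j < i × AdjacentSets G (λ v → lab v ≡ i) (λ v → lab v ≡ j))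

  -- Labels below ℓ name the parts already chosen; label ℓ marks the vertices not yet in a part.
  record Partial (k ℓ : ℕ) (lab : Fin n → ℕ) : Set where
    field
      bounded  : ∀ v → lab v ≤ ℓ
      block    : ∀ {i} → i < ℓ → Block k lab i
      pairwise : ∀ {i j x y} → i < ℓ → j < ℓ → i ≢ j → Reach G (λ v → lab v ≡ ℓ) x y →
                 Touches lab x i → Touches lab y j → AdjacentSets G (λ v → lab v ≡ i) (λ v → lab v ≡ j)

  -- One vertex may touch several parts, so `S` may repeat entries; the bound on terminals counts
  -- entries of the list.
  representatives : ∀ {lab C js} → All (λ j → Any (λ x → Touches lab x j) C) js →
    ∃[ S ] length S ≡ length js × S ⊆ C × (∀ {j} → j ∈ js → Any (λ x → Touches lab x j) S)
  representatives [] = [] , refl , (λ ()) , λ ()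
  representatives (t ∷ ts) with x , x∈ , tx ← find t | S , len , sub , cov ← representatives ts =
    x ∷ S , cong suc len , (λ { (here refl) → x∈ ; (there p) → sub p })
    , λ { (here refl) → here tx ; (there p) → there (cov p) }

  module Relabel {ℓ} {lab : Fin n → ℕ} (bounded : ∀ v → lab v ≤ ℓ)
    (H : List (Fin n)) (H-free : ∀ {v} → v ∈ H → lab v ≡ ℓ) where

    -- The label `ℓ` changes its role from marking free vertices to naming the new part: `H` keeps
    -- it, the other free vertices move up to `suc ℓ`, and older labels stay.
    lab′ : Fin n → ℕ
    lab′ v with lab v ℕ.≟ ℓ | v ∈? H
    ... | yes _ | no _ = suc ℓ
    ... | yes _ | yes _ = lab v
    ... | no _ | _ = lab v

    old⁻ : ∀ {v i} → i < ℓ → lab′ v ≡ i → lab v ≡ i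
    old⁻ {v} i<ℓ eq with lab v ℕ.≟ ℓ | v ∈? H
    ... | yes _ | no _ = contradiction (sym eq) (<⇒≢ (m<n⇒m<1+n i<ℓ))
    ... | yes _ | yes _ = eq
    ... | no _ | _ = eq

    old⁺ : ∀ {v i} → i < ℓ → lab v ≡ i → lab′ v ≡ i
    old⁺ {v} i<ℓ eq with lab v ℕ.≟ ℓ | v ∈? H
    ... | yes p | no _ = contradiction (trans (sym eq) p) (<⇒≢ i<ℓ)
    ... | yes _ | yes _ = eq
    ... | no _ | _ = eq

    new⁻ : ∀ {v} → lab′ v ≡ ℓ → v ∈ H
    new⁻ {v} eq with lab v ℕ.≟ ℓ | v ∈? H
    ... | yes _ | no _ = contradiction eq 1+n≢n
    ... | yes _ | yes p = p
    ... | no ¬p | _ = contradiction eq ¬p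

    new⁺ : ∀ {v} → v ∈ H → lab′ v ≡ ℓ
    new⁺ {v} v∈ with lab v ℕ.≟ ℓ | v ∈? H
    ... | yes _ | no v∉ = contradiction v∈ v∉
    ... | yes p | yes _ = p
    ... | no ¬p | _ = contradiction (H-free v∈) ¬p

    rest⁻ : ∀ {v} → lab′ v ≡ suc ℓ → lab v ≡ ℓ
    rest⁻ {v} eq with lab v ℕ.≟ ℓ | v ∈? H
    ... | yes p | no _ = p
    ... | yes p | yes _ = p
    ... | no _ | _ = contradiction (subst (_≤ ℓ) eq (bounded v)) 1+n≰n

    bounded′ : ∀ v → lab′ v ≤ suc ℓ
    bounded′ v with lab v ℕ.≟ ℓ | v ∈? H
    ... | yes _ | no _ = ≤-refl
    ... | yes _ | yes _ = m≤n⇒m≤1+n (bounded v)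
    ... | no _ | _ = m≤n⇒m≤1+n (bounded v)

  -- Choosing the next part

  module Extend {k ℓ lab} (no-minor : ¬ HasCompleteMinor G (3 + k)) (partial : Partial k ℓ lab)
    {u} (lab-u : lab u ≡ ℓ) where
    open Partial partial

    free? : ∀ v → Dec (lab v ≡ ℓ)
    free? v = lab v ℕ.≟ ℓ

    module C = Component (component free? lab-u)
    C : List (Fin n)
    C = C.verts

    C-touches? : ∀ j → Dec (Any (λ x → Touches lab x j) C)
    C-touches? j = any? (λ x → touches? lab x j) C

    js : List ℕ
    js = filter C-touches? (upTo ℓ)

    js⁻ : ∀ {j} → j ∈ js → j < ℓ × Any (λ x → Touches lab x j) C
    js⁻ p with q , t ← ∈-filter⁻ C-touches? {xs = upTo ℓ} p = ∈-upTo⁻ q , t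

    js⁺ : ∀ {j x} → j < ℓ → x ∈ C → Touches lab x j → j ∈ js
    js⁺ j<ℓ x∈ t = ∈-filter⁺ C-touches? (∈-upTo⁺ j<ℓ) (lose x∈ t)

    -- The branch sets are `C` and the first `2 + k` parts listed in `js`. Two of these parts are
    -- adjacent by `pairwise`, applied to a walk in `C` from a vertex touching one to a vertex
    -- touching the other.
    js-minor : 2 + k ≤ length js → HasCompleteMinor G (3 + k)
    js-minor le = complete-minor B B? disjoint conn adjacent
      where
      g : Fin (2 + k) → ℕ
      g i = lookup js (inject≤ i le)
      g-injective : ∀ {i j} → g i ≡ g j → i ≡ j
      g-injective eq =
        inject≤-injective le le _ _ (lookup-injective (Unique.filter⁺ C-touches? (Unique.upTo⁺ ℓ)) _ _ eq)
      g< : ∀ i → g i < ℓ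
      g< i = proj₁ (js⁻ (∈-lookup (inject≤ i le)))
      B : Fin (3 + k) → Fin n → Set
      B zero v = v ∈ C
      B (suc i) v = lab v ≡ g i
      B? : ∀ i v → Dec (B i v)
      B? zero v = v ∈? C
      B? (suc i) v = lab v ℕ.≟ g i
      disjoint : ∀ {i j v} → B i v → B j v → i ≡ j
      disjoint {zero} {zero} _ _ = refl
      disjoint {zero} {suc j} p q = contradiction (trans (sym q) (C.inside p)) (<⇒≢ (g< j))
      disjoint {suc i} {zero} p q = contradiction (trans (sym p) (C.inside q)) (<⇒≢ (g< i))
      disjoint {suc i} {suc j} p q = cong suc (g-injective (trans (sym p) q))
      conn : ∀ i → ConnectedNonempty G (B i)
      conn zero = grown-connected C.grown
      conn (suc i) = connected-map Bl.label Bl.labelled (grown-connected Bl.grown)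
        where module Bl = Block (block (g< i))
      touch : ∀ i → ∃[ x ] x ∈ C × Touches lab x (g i)
      touch i = find (proj₂ (js⁻ (∈-lookup (inject≤ i le))))
      adjacent : ∀ i j → i ≢ j → AdjacentSets G (B i) (B j)
      adjacent zero zero i≢j = contradiction refl i≢j
      adjacent zero (suc j) _ with x , x∈ , w , w∈ , a ← touch j = x , w , x∈ , w∈ , a
      adjacent (suc i) zero _ with x , x∈ , w , w∈ , a ← touch i = w , x , w∈ , x∈ , adj-sym a
      adjacent (suc i) (suc j) i≢j with x , x∈ , tx ← touch i | y , y∈ , ty ← touch j =
        pairwise (g< i) (g< j) (i≢j ∘ cong suc ∘ g-injective)
          (reach-map C.inside (proj₂ (grown-connected C.grown) x y x∈ y∈)) tx ty

    |js|≤ : length js ≤ suc k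
    |js|≤ = s≤s⁻¹ (≰⇒> (no-minor ∘ js-minor))

    abstract
      terminals : ∃[ r ] ∃[ S ] r ∈ S × length S ≤ suc k × S ⊆ C × (∀ {j} → j ∈ js → Any (λ x → Touches lab x j) S)
      terminals with representatives {lab} {C} {js} (All.tabulate (proj₂ ∘ js⁻))
      -- If no part touches `C`, the vertex `u` serves as terminal, since the search order needs a
      -- terminal as its root.
      ... | [] , _ , _ , cov = u , [ u ] , here refl , s≤s z≤n
        , (λ { (here refl) → root∈ C.grown }) , (λ p → contradiction (cov p) λ ())
      ... | x ∷ S , len , sub , cov = x , x ∷ S , here refl , subst (_≤ suc k) (sym len) |js|≤ , sub , cov

    r : Fin n
    r = proj₁ terminals
    S : List (Fin n)
    S = proj₁ (proj₂ terminals)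
    r∈S : r ∈ S
    r∈S = proj₁ (proj₂ (proj₂ terminals))
    S⊆C : S ⊆ C
    S⊆C = proj₁ (proj₂ (proj₂ (proj₂ (proj₂ terminals))))
    S-touches : ∀ {j} → j ∈ js → Any (λ x → Touches lab x j) S
    S-touches = proj₂ (proj₂ (proj₂ (proj₂ (proj₂ terminals))))

    -- `C` was grown from `u`; it is explored again from `r` because the root given to `skeleton`
    -- has to be a terminal.
    module C′ = Component (component (_∈? C) (S⊆C r∈S))

    sk : Skeleton k C′.verts S
    sk = skeleton C′.grown (proj₁ (proj₂ (proj₂ (proj₂ terminals)))) r∈S
      (λ p → C′.reach-closed (root∈ C′.grown) (proj₂ (grown-connected C.grown) r _ (S⊆C r∈S) (S⊆C p)))

    module Sk = Skeleton sk
    H : List (Fin n)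
    H = Sk.verts
    H⊆C : H ⊆ C
    H⊆C p = C′.inside (Sk.verts⊆ p)

    open Relabel bounded H (C.inside ∘ H⊆C) public

    block′ : ∀ {i} → i < suc ℓ → Block k lab′ i
    block′ {i} i<1+ℓ with m<1+n⇒m<n∨m≡n i<1+ℓ
    ... | inj₁ i<ℓ = record
      { skel = Bl.skel ; label = old⁺ i<ℓ ∘ Bl.label ; labelled = Bl.labelled ∘ old⁻ i<ℓ
      ; earlier = covered-map ≤-refl
          (λ { (j<i , a) → j<i , adjacent-map (old⁻ i<ℓ) (old⁻ (<-trans j<i i<ℓ)) a }) Bl.earlier }
      where module Bl = Block (block i<ℓ)
    ... | inj₂ refl = record
      { skel = sk ; label = new⁺ ; labelled = new⁻
      -- An earlier part adjacent to `H` touches `C`, so its label is in `js`.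
      ; earlier = js , |js|≤ , λ { (j<ℓ , x , w , x≡ , w≡ , a) → js⁺ j<ℓ (H⊆C (new⁻ x≡)) (w , old⁻ j<ℓ w≡ , a) } }

    touches-old : ∀ {x i} → i < ℓ → Touches lab′ x i → Touches lab x i
    touches-old i<ℓ (w , w≡ , a) = w , old⁻ i<ℓ w≡ , a

    -- Here the terminals do their work. A neighbour of `x` lies in the new part, so the walk from
    -- `x` to `y` runs inside `C`. Hence part `j` touches `C`, and some terminal, which lies in the
    -- new part, is adjacent to it.
    new-pairwise : ∀ {j x y} → j < ℓ → Reach G (λ v → lab′ v ≡ suc ℓ) x y →
      Touches lab′ x ℓ → Touches lab′ y j → AdjacentSets G (λ v → lab′ v ≡ ℓ) (λ v → lab′ v ≡ j)
    new-pairwise j<ℓ ρ (w , w≡ , a) ty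
      with x∈C ← C.closed (H⊆C (new⁻ w≡)) (rest⁻ (reach-start ρ)) (adj-sym a)
      with y∈C ← C.reach-closed x∈C (reach-map rest⁻ ρ)
      with z , z∈S , w′ , w′≡ , b ← find (S-touches (js⁺ j<ℓ y∈C (touches-old j<ℓ ty))) =
      z , w′ , new⁺ (Sk.⊆verts z∈S) , old⁺ j<ℓ w′≡ , b

    pairwise′ : ∀ {i j x y} → i < suc ℓ → j < suc ℓ → i ≢ j → Reach G (λ v → lab′ v ≡ suc ℓ) x y →
      Touches lab′ x i → Touches lab′ y j → AdjacentSets G (λ v → lab′ v ≡ i) (λ v → lab′ v ≡ j)
    pairwise′ i< j< i≢j ρ tx ty with m<1+n⇒m<n∨m≡n i< | m<1+n⇒m<n∨m≡n j<
    ... | inj₁ i<ℓ | inj₁ j<ℓ = adjacent-map (old⁺ i<ℓ) (old⁺ j<ℓ)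
      (pairwise i<ℓ j<ℓ i≢j (reach-map rest⁻ ρ) (touches-old i<ℓ tx) (touches-old j<ℓ ty))
    ... | inj₁ i<ℓ | inj₂ refl = adjacent-sym (new-pairwise i<ℓ (reach-sym ρ) ty tx)
    ... | inj₂ refl | inj₁ j<ℓ = new-pairwise j<ℓ ρ tx ty
    ... | inj₂ refl | inj₂ refl = contradiction refl i≢j

    partial′ : Partial k (suc ℓ) lab′
    partial′ = record { bounded = bounded′ ; block = block′ ; pairwise = pairwise′ }

    r-removed : lab r ≡ ℓ × lab′ r ≢ suc ℓ
    r-removed = C.inside (S⊆C r∈S) , λ eq → 1+n≢n (trans (sym eq) (new⁺ (Sk.⊆verts r∈S)))

  -- Iteration and the theorem

  free : ℕ → (Fin n → ℕ) → List (Fin n)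
  free ℓ lab = filter (λ v → lab v ℕ.≟ ℓ) (allFin n)

  -- Every round puts at least the terminal `r` into a part, so the number of free vertices, bounded
  -- by `m`, falls.
  complete : ∀ m {k ℓ lab} → ¬ HasCompleteMinor G (3 + k) → Partial k ℓ lab → length (free ℓ lab) ≤ m →
    ∃[ ℓ′ ] ∃[ lab′ ] Partial k ℓ′ lab′ × (∀ v → lab′ v < ℓ′)
  complete m {k} {ℓ} {lab} no-minor partial len with Fin.any? (λ v → lab v ℕ.≟ ℓ)
  ... | no none = ℓ , lab , partial , λ v → ≤∧≢⇒< (Partial.bounded partial v) λ eq → none (v , eq)
  complete m {k} {ℓ} {lab} no-minor partial len | yes (u , lab-u) = recurse m len
    where
    module E = Extend no-minor partial lab-u
    free⁺ : ∀ {ℓ lab v} → lab v ≡ ℓ → v ∈ free ℓ lab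
    free⁺ = ∈-filter⁺ _ (∈-allFin _)
    free⁻ : ∀ {ℓ lab v} → v ∈ free ℓ lab → lab v ≡ ℓ
    free⁻ p = proj₂ (∈-filter⁻ _ {xs = allFin n} p)
    shrink : E.r ∷ free (suc ℓ) E.lab′ ⊆ free ℓ lab
    shrink (here refl) = free⁺ (proj₁ E.r-removed)
    shrink (there p) = free⁺ (E.rest⁻ (free⁻ p))
    less : length (free (suc ℓ) E.lab′) < length (free ℓ lab)
    less = unique-⊆-≤ (unique-∷ (proj₂ E.r-removed ∘ free⁻) (Unique.filter⁺ _ (Unique.allFin⁺ n))) shrink
    recurse : ∀ m → length (free ℓ lab) ≤ m → ∃[ ℓ′ ] ∃[ lab′ ] Partial k ℓ′ lab′ × (∀ v → lab′ v < ℓ′)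
    recurse zero len = contradiction (≤-trans less len) λ ()
    recurse (suc m) len = complete m no-minor E.partial′ (s≤s⁻¹ (≤-trans less len))

  partition : ∀ {k} → ¬ HasCompleteMinor G (3 + k) → ∃[ ℓ ] ∃[ lab ] Partial k ℓ lab × (∀ v → lab v < ℓ)
  -- For `ℓ = 0` the constant label `0` makes every vertex free.
  partition no-minor = complete n {ℓ = 0} {lab = λ _ → 0} no-minor
    (record { bounded = λ _ → z≤n ; block = λ () ; pairwise = λ () })
    (≤-trans (length-filter _ (allFin n)) (≤-reflexive (length-tabulate id)))

theorem3 : (t : ℕ) → 4 ≤ t → (n : ℕ) → (G : Graph n) → ¬ HasCompleteMinor G t →
    Σ ℕ λ ℓ → Σ (Fin n → Fin ℓ) λ part →
    IsConnectedPartition G part ×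
    (∀ (i : Fin ℓ) →
    FewEarlierNeighbours G (t ∸ 2) part i ×
    MaxDegreeAtMost G (t ∸ 2) part i ×
    TwoColourableClustering G ⌈ t ∸ 2 /2⌉ part i)
-- With t = 3 + k the bound t - 2 is `suc k`, the bound on the number of terminals.
theorem3 (suc (suc (suc k))) (s≤s (s≤s (s≤s _))) n G no-minor with WithGraph.partition G no-minor
... | ℓ , lab , partial , lab< = ℓ , part , connected , λ i → few i , degree i , colourable i
  where
  open WithGraph G
  part : Fin n → Fin ℓ
  part v = fromℕ< (lab< v)
  to : ∀ {i v} → lab v ≡ toℕ i → part v ≡ i
  to {v = v} eq = toℕ-injective (trans (toℕ-fromℕ< (lab< v)) eq)
  from : ∀ {i v} → part v ≡ i → lab v ≡ toℕ i
  from {v = v} eq = trans (sym (toℕ-fromℕ< (lab< v))) (cong toℕ eq)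
  module B (i : Fin ℓ) = Block (Partial.block partial (toℕ<n i))
  vert : ∀ {i v} → part v ≡ i → v ∈ B.verts i
  vert {i} eq = B.labelled i (from eq)
  connected : IsConnectedPartition G part
  connected i = connected-map (to ∘ B.label i) vert (grown-connected (B.grown i))
  few : ∀ i → FewEarlierNeighbours G (suc k) part i
  few i xs unique all with ys , len , cov ← B.earlier i = begin
    length xs             ≡⟨ length-map toℕ xs ⟨
    length (map toℕ xs)   ≤⟨ unique-⊆-length ℕ._≟_ (Unique.map⁺ toℕ-injective unique) sub ⟩
    length ys             ≤⟨ len ⟩
    suc k                 ∎
    where
    open ≤-Reasoning
    sub : map toℕ xs ⊆ ys
    sub p with j , j∈ , refl ← ∈-map⁻ toℕ p
      with j<i , a ← All.lookup all j∈ = cov (j<i , adjacent-map from from a)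
  degree : ∀ i → MaxDegreeAtMost G (suc k) part i
  degree i v v∈ = covered⇒AtMost (covered-map ≤-refl (λ { (u∈ , a) → vert u∈ , a }) (B.degree i (vert v∈)))
  colourable : ∀ i → TwoColourableClustering G ⌈ suc k /2⌉ part i
  colourable i = B.colour i , λ v v∈ →
    covered⇒AtMost (covered-map ≤-refl (reach-map λ { (w∈ , eq) → vert w∈ , eq }) (B.cluster i (vert v∈)))
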